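{- Let $t<k\le n$ and $\lambda$ be positive integers. If there exist a Steiner system S$(t,k,n)$ and a perpendicular array PA$_\lambda(k,n,n)$, then there exists a large set with multiplicity LS$(t,k,n;\mu)$, where $\mu=\lambda\binom{n}{t}\big/\binom{k}{t}$.
   Context: A Steiner system S$(t,k,n)$ is a pair $(Q,B)$ where $Q$ is an $n$-set and $B$ is a collection of $k$-subsets (blocks) of $Q$ such that every $t$-subset of $Q$ is contained in exactly one block. A large set with multiplicity $\mu$, LS$(t,k,n;\mu)$, is a family (the same system may occur more than once) of Steiner systems S$(t,k,n)$ on a common $n$-set $Q$ such that every $k$-subset of $Q$ is a block of exactly $\mu$ of the systems. A perpendicular array PA$_\lambda(k,\ell,n)$ is a $\lambda\binom{n}{k}\times \ell$ matrix with entries from an $n$-set such that each row has $\ell$ distinct entries and, in the submatrix formed by any $k$ columns, each $k$-subset of the $n$-set occurs (as the set of entries of a row) exactly $\lambda$ times; for $\ell=n$ its rows are permutations of the $n$-set. -}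

module Defs where

open import Data.Bool.Properties using () renaming (_≟_ to _≟ᵇ_)
open import Data.Fin.Base using (Fin)
open import Data.Fin.Properties using (_≟_; any?)
open import Data.Fin.Subset using (Subset; ∣_∣; _∈_; _⊆_)
open import Data.Fin.Subset.Properties using (_∈?_)
open import Data.Nat.Base using (ℕ; _*_)
open import Data.Nat.Combinatorics using (_C_)
open import Data.Product using (∃!; _×_)
open import Data.Vec.Base using (tabulate; allFin; count)
open import Data.Vec.Functional using (Vector)
open import Data.Vec.Properties using (≡-dec)
open import Function.Definitions using (Injective)
open import Level using (0ℓ; suc)
open import Relation.Binary.Definitions using (DecidableEquality)
open import Relation.Binary.PropositionalEquality.Core using (_≡_)
open import Relation.Nullary.Decidable using (does; _×-dec_)
open import Relation.Unary using (Pred; Decidable)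

-- The number of indices satisfying P; indices, not values, are counted,
-- so repeated members of an indexed family count with multiplicity.
number : ∀ {m} {P : Pred (Fin m) 0ℓ} → Decidable P → ℕ
number {m} P? = count P? (allFin m)

infix 4 _≟ˢ_
_≟ˢ_ : ∀ {n} → DecidableEquality (Subset n)
_≟ˢ_ = ≡-dec _≟ᵇ_

-- The set of entries of a row in the columns belonging to C.
entries : ∀ {ℓ n} → Vector (Fin n) ℓ → Subset ℓ → Subset n
entries row C = tabulate λ y → does (any? λ c → (c ∈? C) ×-dec (row c ≟ y))

-- Fin n serves as the common n-set of all structures.
record SteinerSystem (t k n : ℕ) : Set (suc 0ℓ) where
  field
    Block      : Pred (Subset n) 0ℓ
    Block?     : Decidable Block
    block-size : ∀ {K} → Block K → ∣ K ∣ ≡ k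
    covered    : ∀ T → ∣ T ∣ ≡ t → ∃! _≡_ λ K → Block K × T ⊆ K

record LargeSet (t k n μ : ℕ) : Set (suc 0ℓ) where
  field
    size         : ℕ
    system       : Fin size → SteinerSystem t k n
    multiplicity : ∀ K → ∣ K ∣ ≡ k →
                   number (λ i → SteinerSystem.Block? (system i) K) ≡ μ

record PerpendicularArray (lam k ℓ n : ℕ) : Set where
  field
    row          : Vector (Vector (Fin n) ℓ) (lam * (n C k))
    row-distinct : ∀ r → Injective _≡_ _≡_ (row r)
    occurrences  : ∀ (C : Subset ℓ) → ∣ C ∣ ≡ k →
                   ∀ (K : Subset n) → ∣ K ∣ ≡ k →
                   number (λ r → entries (row r) C ≟ˢ K) ≡ lam

{-# OPTIONS --safe #-}
-- Let b be the number of blocks of the given Steiner system.  Each row of the array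
-- is a permutation of the n-set, and its image of the Steiner system is again one.
-- A k-set K is a block of the image under row r exactly when K is the set of entries
-- of r in the columns of some block C; each block C contributes λ such rows, so
-- μ = λ b.  Counting the pairs T ⊆ K with T a t-set and K a block gives
-- b · C(k,t) = C(n,t).
module Submission where

open import Data.Bool.Base using (true; false; if_then_else_)
import Data.Bool.Properties as Bool
open import Data.Fin.Base using (Fin; punchOut)
open import Data.Fin.Permutation
  using (Permutation′; permutation; flip; _⟨$⟩ʳ_; _⟨$⟩ˡ_; inverseˡ; inverseʳ)
open import Data.Fin.Properties using (any?; injective⇒≤; punchOut-injective)
  renaming (_≟_ to _≟ᶠ_)
open import Data.Fin.Subset using (Subset; inside; outside; ∣_∣; _∈_; _⊆_; ⊤)
open import Data.Fin.Subset.Properties using (_∈?_; _⊆?_; ⊆⊤; ∣⊤∣≡n)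
open import Data.Nat.Base using (ℕ; zero; suc; _+_; _*_; _<_; _≤_; z≤n)
open import Data.Nat.Combinatorics
  using (_C_; nCk≡nC[n∸k]; nCn≡1; nCk+nC[k+1]≡[n+1]C[k+1])
open import Data.Nat.Properties
  using (_≟_; +-identityʳ; *-identityʳ; *-zeroʳ; *-assoc; *-comm;
         *-distribʳ-+; 1+n≰n; +-*-semiring; +-commutativeSemigroup;
         *-commutativeSemigroup)
open import Data.Product.Base using (∃-syntax; _×_; _,_; proj₁; proj₂)
open import Data.Vec.Base using ([]; _∷_; lookup; tabulate; count)
open import Data.Vec.Properties
  using (lookup∘tabulate; tabulate∘lookup; tabulate-cong; []=⇒lookup; lookup⇒[]=)
open import Function.Base using (_∘_; id)
open import Function.Bundles using (_⇔_; mk⇔)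
open import Function.Definitions using (Injective)
open import Level using (0ℓ)
open import Relation.Binary.PropositionalEquality
open import Relation.Nullary.Decidable using (Dec; does; yes; no; _×-dec_; does-⇔; dec-true)
open import Relation.Nullary.Negation using (contradiction)
open import Relation.Unary using (Pred; Decidable)
open import Algebra.Properties.CommutativeSemigroup +-commutativeSemigroup
  using (interchange)
open import Algebra.Properties.CommutativeSemigroup *-commutativeSemigroup
  using (x∙yz≈y∙xz)
open import Algebra.Properties.Semiring.Sum +-*-semiring
  using (sum; sum-cong-≗; ∑-distrib-+; *-distribʳ-sum; sum-permute)
open import Defs

open ≡-Reasoning

private variable
  m n : ℕ
  P Q : Set

-- Indicators of decidable propositions.

𝟙 : Dec P → ℕ
𝟙 P? = if does P? then 1 else 0

𝟙-cong : P ⇔ Q → (P? : Dec P) (Q? : Dec Q) → 𝟙 P? ≡ 𝟙 Q?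
𝟙-cong P⇔Q P? Q? = cong (if_then 1 else 0) (does-⇔ P⇔Q P? Q?)

𝟙-true : (P? : Dec P) → P → 𝟙 P? ≡ 1
𝟙-true P? p = cong (if_then 1 else 0) (dec-true P? p)

𝟙-×-dec : (P? : Dec P) (Q? : Dec Q) → 𝟙 (P? ×-dec Q?) ≡ 𝟙 P? * 𝟙 Q?
𝟙-×-dec P? Q? with does P?
... | true  = sym (+-identityʳ (𝟙 Q?))
... | false = refl

-- Allows an equation that is known only under `P` to be used inside a sum over everything, where
-- the indicator kills the remaining terms.
𝟙-*-congˡ : (P? : Dec P) → ∀ {x y} → (P → x ≡ y) → 𝟙 P? * x ≡ 𝟙 P? * y
𝟙-*-congˡ (yes p) x≡y = cong (1 *_) (x≡y p)
𝟙-*-congˡ (no _)  x≡y = refl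

-- Both `number` and `∣_∣` are instances of `count`, so this makes either one accessible to
-- permuting, exchanging and rescaling sums.
count-tabulate : ∀ {A : Set} {P : Pred A 0ℓ} (P? : Decidable P) (f : Fin m → A) →
                 count P? (tabulate f) ≡ sum (λ i → 𝟙 (P? (f i)))
count-tabulate {zero}  P? f = refl
count-tabulate {suc m} P? f with does (P? (f Fin.zero))
... | true  = cong suc (count-tabulate P? (f ∘ Fin.suc))
... | false = count-tabulate P? (f ∘ Fin.suc)

-- Sums over all subsets of an n-set.

sumˢ : (Subset n → ℕ) → ℕ
sumˢ {zero}  f = f []
sumˢ {suc n} f = sumˢ (f ∘ (inside ∷_)) + sumˢ (f ∘ (outside ∷_))

sumˢ-cong : {f g : Subset n → ℕ} → f ≗ g → sumˢ f ≡ sumˢ g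
sumˢ-cong {zero}  f≗g = f≗g []
sumˢ-cong {suc n} f≗g =
  cong₂ _+_ (sumˢ-cong (f≗g ∘ (inside ∷_))) (sumˢ-cong (f≗g ∘ (outside ∷_)))

sumˢ-zero : ∀ n → sumˢ {n} (λ _ → 0) ≡ 0
sumˢ-zero zero    = refl
sumˢ-zero (suc n) = cong₂ _+_ (sumˢ-zero n) (sumˢ-zero n)

sumˢ-distrib-+ : (f g : Subset n → ℕ) → sumˢ (λ S → f S + g S) ≡ sumˢ f + sumˢ g
sumˢ-distrib-+ {zero}  f g = refl
sumˢ-distrib-+ {suc n} f g = trans
  (cong₂ _+_ (sumˢ-distrib-+ (f ∘ (inside ∷_)) (g ∘ (inside ∷_)))
             (sumˢ-distrib-+ (f ∘ (outside ∷_)) (g ∘ (outside ∷_))))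
  (interchange (sumˢ (f ∘ (inside ∷_))) _ _ _)

*-distribʳ-sumˢ : ∀ c (f : Subset n → ℕ) → sumˢ f * c ≡ sumˢ (λ S → f S * c)
*-distribʳ-sumˢ {zero}  c f = refl
*-distribʳ-sumˢ {suc n} c f = trans
  (*-distribʳ-+ c (sumˢ (f ∘ (inside ∷_))) _)
  (cong₂ _+_ (*-distribʳ-sumˢ c (f ∘ (inside ∷_))) (*-distribʳ-sumˢ c (f ∘ (outside ∷_))))

*-distribˡ-sumˢ : ∀ c (f : Subset n → ℕ) → c * sumˢ f ≡ sumˢ (λ S → c * f S)
*-distribˡ-sumˢ c f = trans (*-comm c (sumˢ f))
  (trans (*-distribʳ-sumˢ c f) (sumˢ-cong λ S → *-comm (f S) c))

-- `sumˢ` is built from binary additions alone, so additivity carries `F` through it. An abstract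
-- `F` covers both exchanges of summation below: with another `sumˢ`, and with a sum over the rows
-- of the array.
additive-commutes-sumˢ : ∀ {A : Set} (F : (A → ℕ) → ℕ) →
                         (∀ f g → F (λ a → f a + g a) ≡ F f + F g) →
                         (f : Subset n → A → ℕ) →
                         F (λ a → sumˢ (λ S → f S a)) ≡ sumˢ (λ S → F (f S))
additive-commutes-sumˢ {zero}  F F-+ f = refl
additive-commutes-sumˢ {suc n} F F-+ f = trans (F-+ _ _)
  (cong₂ _+_ (additive-commutes-sumˢ F F-+ (f ∘ (inside ∷_)))
             (additive-commutes-sumˢ F F-+ (f ∘ (outside ∷_))))

-- At each point, the half of the subsets that disagree with `S` there contributes only zeros.
sumˢ-δ : (S : Subset n) (f : Subset n → ℕ) → sumˢ (λ S′ → 𝟙 (S′ ≟ˢ S) * f S′) ≡ f S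
sumˢ-δ []                    f = +-identityʳ (f [])
sumˢ-δ {suc n} (inside  ∷ S) f = begin
  sumˢ (λ S′ → 𝟙 (S′ ≟ˢ S) * f (inside ∷ S′)) + sumˢ {n} (λ _ → 0)
    ≡⟨ cong₂ _+_ (sumˢ-δ S (f ∘ (inside ∷_))) (sumˢ-zero n) ⟩
  f (inside ∷ S) + 0
    ≡⟨ +-identityʳ _ ⟩
  f (inside ∷ S) ∎
sumˢ-δ {suc n} (outside ∷ S) f = cong₂ _+_ (sumˢ-zero n) (sumˢ-δ S (f ∘ (outside ∷_)))

nC0≡1 : ∀ n → n C 0 ≡ 1
nC0≡1 n = trans (nCk≡nC[n∸k] {0} {n} z≤n) (nCn≡1 n)

-- Pascal's rule: the sets `T` are split by whether they contain the first point. Taking `K` to be a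
-- block or `⊤` gives the two counts needed for the block number.
sumˢ-subsets-of-size : ∀ t (K : Subset n) →
                       sumˢ (λ T → 𝟙 (∣ T ∣ ≟ t) * 𝟙 (T ⊆? K)) ≡ ∣ K ∣ C t
sumˢ-subsets-of-size         zero    []            = refl
sumˢ-subsets-of-size         (suc t) []            = refl
-- A set containing the first point is never empty, so for size 0 the first half of the sum vanishes
-- by computation.
sumˢ-subsets-of-size {suc n} zero    (inside  ∷ K) = begin
  sumˢ {n} (λ _ → 0) + sumˢ (λ T → 𝟙 (∣ T ∣ ≟ 0) * 𝟙 (T ⊆? K))
    ≡⟨ cong₂ _+_ (sumˢ-zero n) (sumˢ-subsets-of-size zero K) ⟩
  ∣ K ∣ C 0
    ≡⟨ trans (nC0≡1 ∣ K ∣) (sym (nC0≡1 (suc ∣ K ∣))) ⟩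
  suc ∣ K ∣ C 0 ∎
sumˢ-subsets-of-size         (suc t) (inside  ∷ K) = trans
  (cong₂ _+_ (sumˢ-subsets-of-size t K) (sumˢ-subsets-of-size (suc t) K))
  (nCk+nC[k+1]≡[n+1]C[k+1] ∣ K ∣ t)
-- The first point is missing from `K`, so no `T` containing it lies in `K`, whatever its size.
sumˢ-subsets-of-size {suc n} t       (outside ∷ K) = cong₂ _+_
  (trans (sumˢ-cong {n} λ T → *-zeroʳ (𝟙 (suc ∣ T ∣ ≟ t))) (sumˢ-zero n))
  (sumˢ-subsets-of-size t K)

-- Permutations and their action on subsets.

injective⇒surjective : (f : Fin n → Fin n) → Injective _≡_ _≡_ f → ∀ y → ∃[ x ] f x ≡ y
injective⇒surjective {suc n} f f-inj y with any? (λ x → f x ≟ᶠ y)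
... | yes hit = hit
-- Pigeonhole: deleting the missed value `y` from the codomain would leave an injection from `suc n`
-- points into `n`.
... | no miss = contradiction
  (injective⇒≤ {f = λ x → punchOut (y≢f x)} (f-inj ∘ punchOut-injective (y≢f _) (y≢f _)))
  1+n≰n
  where
  y≢f : ∀ x → y ≢ f x
  y≢f x y≡fx = miss (x , sym y≡fx)

injective⇒permutation : (f : Fin n → Fin n) → Injective _≡_ _≡_ f → Permutation′ n
injective⇒permutation f f-inj =
  permutation f (proj₁ ∘ surjective) (proj₂ ∘ surjective)
              (λ i → f-inj (proj₂ (surjective (f i))))
  where surjective = injective⇒surjective f f-inj

-- Membership is read off through the inverse, which avoids a search for preimages and makes the
-- round trips below pointwise.
image : Permutation′ n → Subset n → Subset n
image π S = tabulate (λ y → lookup S (π ⟨$⟩ˡ y))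

image-flip-image : (π : Permutation′ n) (S : Subset n) → image (flip π) (image π S) ≡ S
image-flip-image π S = trans
  (tabulate-cong λ i → trans (lookup∘tabulate _ (π ⟨$⟩ʳ i)) (cong (lookup S) (inverseˡ π)))
  (tabulate∘lookup S)

image-image-flip : (π : Permutation′ n) (S : Subset n) → image π (image (flip π) S) ≡ S
image-image-flip π S = image-flip-image (flip π) S

image-mono-⊆ : (π : Permutation′ n) {S S′ : Subset n} → S ⊆ S′ → image π S ⊆ image π S′
image-mono-⊆ π {S} {S′} S⊆S′ {y} y∈πS = lookup⇒[]= y _
  (trans (lookup∘tabulate _ y) ([]=⇒lookup (S⊆S′ (lookup⇒[]= (π ⟨$⟩ˡ y) S
    (trans (sym (lookup∘tabulate _ y)) ([]=⇒lookup y∈πS))))))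

-- The size is a sum of membership indicators, and `π` merely permutes the summands.
∣image∣ : (π : Permutation′ n) (S : Subset n) → ∣ image π S ∣ ≡ ∣ S ∣
∣image∣ π S = begin
  ∣ image π S ∣
    ≡⟨ count-tabulate (Bool._≟ inside) (λ y → lookup S (π ⟨$⟩ˡ y)) ⟩
  sum (λ y → 𝟙 (lookup S (π ⟨$⟩ˡ y) Bool.≟ inside))
    ≡⟨ sum-permute (λ x → 𝟙 (lookup S x Bool.≟ inside)) (flip π) ⟨
  sum (λ x → 𝟙 (lookup S x Bool.≟ inside))
    ≡⟨ count-tabulate (Bool._≟ inside) (lookup S) ⟨
  ∣ tabulate (lookup S) ∣
    ≡⟨ cong ∣_∣ (tabulate∘lookup S) ⟩
  ∣ S ∣ ∎

does-≟-inside : ∀ b → does (b Bool.≟ inside) ≡ b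
does-≟-inside true  = refl
does-≟-inside false = refl

-- The search in `entries` for a column holding `y` has only one candidate, `π ⟨$⟩ˡ y`.
entries≡image : (π : Permutation′ n) (S : Subset n) → entries (π ⟨$⟩ʳ_) S ≡ image π S
entries≡image π S = tabulate-cong λ y → trans
  (does-⇔ (mk⇔ (λ (c , c∈S , πc≡y) → []=⇒lookup
                  (subst (_∈ S) (trans (sym (inverseˡ π)) (cong (π ⟨$⟩ˡ_) πc≡y)) c∈S))
               (λ eq → π ⟨$⟩ˡ y , lookup⇒[]= _ S eq , inverseʳ π))
          (any? λ c → (c ∈? S) ×-dec (π ⟨$⟩ʳ c ≟ᶠ y)) (lookup S (π ⟨$⟩ˡ y) Bool.≟ inside))
  (does-≟-inside _)

-- Links the condition counted by the perpendicular array, on the left, to one that singles out `S`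
-- and so can be summed by `sumˢ-δ`.
entries≡⇔≡image-flip : (π : Permutation′ n) (S K : Subset n) →
                       entries (π ⟨$⟩ʳ_) S ≡ K ⇔ S ≡ image (flip π) K
entries≡⇔≡image-flip π S K = mk⇔
  (λ eq → trans (sym (image-flip-image π S))
                (cong (image (flip π)) (trans (sym (entries≡image π S)) eq)))
  (λ eq → trans (entries≡image π S) (trans (cong (image π) eq) (image-image-flip π K)))

-- Images of a Steiner system and its number of blocks.

module _ {t k : ℕ} (𝓢 : SteinerSystem t k n) where
  open SteinerSystem 𝓢

  #blocks : ℕ
  #blocks = sumˢ (λ K → 𝟙 (Block? K))

  -- Blocks are described by their preimages, so decidability is inherited. To cover `T`, it is
  -- pulled back, covered by `K` in the original system, and `K` is pushed forward.
  imageSystem : Permutation′ n → SteinerSystem t k n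
  imageSystem π = record
    { Block      = λ K → Block (π⁻¹ K)
    ; Block?     = λ K → Block? (π⁻¹ K)
    ; block-size = λ {K} B → trans (sym (∣image∣ (flip π) K)) (block-size B)
    ; covered    = λ T ∣T∣≡t →
        let K , (B , π⁻¹T⊆K) , unique = covered (π⁻¹ T) (trans (∣image∣ (flip π) T) ∣T∣≡t)
        in image π K
         , ( subst Block (sym (image-flip-image π K)) B
           , subst (_⊆ image π K) (image-image-flip π T) (image-mono-⊆ π π⁻¹T⊆K) )
         -- A competing block `K′` pulls back to a block containing the preimage of `T`, hence to
         -- `K`.
         , λ {K′} (B′ , T⊆K′) →
             trans (cong (image π) (unique (B′ , image-mono-⊆ (flip π) T⊆K′)))
                   (image-image-flip π K′)
    }
    where π⁻¹ = image (flip π)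

  private
    incidences : Subset n → Subset n → ℕ
    incidences K T = 𝟙 (Block? K) * (𝟙 (∣ T ∣ ≟ t) * 𝟙 (T ⊆? K))

  incidences-at-block : ∀ K → sumˢ (incidences K) ≡ 𝟙 (Block? K) * (k C t)
  incidences-at-block K = begin
    sumˢ (λ T → 𝟙 (Block? K) * (𝟙 (∣ T ∣ ≟ t) * 𝟙 (T ⊆? K)))
      ≡⟨ *-distribˡ-sumˢ (𝟙 (Block? K)) (λ T → 𝟙 (∣ T ∣ ≟ t) * 𝟙 (T ⊆? K)) ⟨
    𝟙 (Block? K) * sumˢ (λ T → 𝟙 (∣ T ∣ ≟ t) * 𝟙 (T ⊆? K))
      ≡⟨ cong (𝟙 (Block? K) *_) (sumˢ-subsets-of-size t K) ⟩
    𝟙 (Block? K) * (∣ K ∣ C t)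
      ≡⟨ 𝟙-*-congˡ (Block? K) (λ B → cong (_C t) (block-size B)) ⟩
    𝟙 (Block? K) * (k C t) ∎

  -- Being a block that contains `T` is equivalent to being equal to the block `K₀` that covers `T`,
  -- so the sum collapses to a single term.
  unique-incidence : ∀ T → ∣ T ∣ ≡ t → sumˢ (λ K → 𝟙 (Block? K) * 𝟙 (T ⊆? K)) ≡ 1
  unique-incidence T ∣T∣≡t with K₀ , incident , unique ← covered T ∣T∣≡t = begin
    sumˢ (λ K → 𝟙 (Block? K) * 𝟙 (T ⊆? K))
      ≡⟨ sumˢ-cong (λ K → 𝟙-×-dec (Block? K) (T ⊆? K)) ⟨
    sumˢ (λ K → 𝟙 (Block? K ×-dec T ⊆? K))
      ≡⟨ sumˢ-cong (λ K → 𝟙-cong (mk⇔ (λ p → sym (unique p)) (λ { refl → incident }))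
                                 (Block? K ×-dec T ⊆? K) (K ≟ˢ K₀)) ⟩
    sumˢ (λ K → 𝟙 (K ≟ˢ K₀))
      ≡⟨ sumˢ-cong (λ K → *-identityʳ (𝟙 (K ≟ˢ K₀))) ⟨
    sumˢ (λ K → 𝟙 (K ≟ˢ K₀) * 1)
      ≡⟨ sumˢ-δ K₀ (λ _ → 1) ⟩
    1 ∎

  -- The factor for `T ⊆ ⊤` equals 1; it is kept so that summing over `T` becomes the case `K = ⊤`
  -- of `sumˢ-subsets-of-size`.
  incidences-at-point-set : ∀ T → sumˢ (λ K → incidences K T) ≡ 𝟙 (∣ T ∣ ≟ t) * 𝟙 (T ⊆? ⊤)
  incidences-at-point-set T = begin
    sumˢ (λ K → 𝟙 (Block? K) * (𝟙 (∣ T ∣ ≟ t) * 𝟙 (T ⊆? K)))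
      ≡⟨ sumˢ-cong (λ K → x∙yz≈y∙xz (𝟙 (Block? K)) (𝟙 (∣ T ∣ ≟ t)) (𝟙 (T ⊆? K))) ⟩
    sumˢ (λ K → 𝟙 (∣ T ∣ ≟ t) * (𝟙 (Block? K) * 𝟙 (T ⊆? K)))
      ≡⟨ *-distribˡ-sumˢ (𝟙 (∣ T ∣ ≟ t)) (λ K → 𝟙 (Block? K) * 𝟙 (T ⊆? K)) ⟨
    𝟙 (∣ T ∣ ≟ t) * sumˢ (λ K → 𝟙 (Block? K) * 𝟙 (T ⊆? K))
      ≡⟨ 𝟙-*-congˡ (∣ T ∣ ≟ t) (λ ∣T∣≡t → trans (unique-incidence T ∣T∣≡t)
                                                (sym (𝟙-true (T ⊆? ⊤) ⊆⊤))) ⟩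
    𝟙 (∣ T ∣ ≟ t) * 𝟙 (T ⊆? ⊤) ∎

  #blocks*kCt≡nCt : #blocks * (k C t) ≡ n C t
  #blocks*kCt≡nCt = begin
    #blocks * (k C t)
      ≡⟨ *-distribʳ-sumˢ (k C t) (λ K → 𝟙 (Block? K)) ⟩
    sumˢ (λ K → 𝟙 (Block? K) * (k C t))
      ≡⟨ sumˢ-cong incidences-at-block ⟨
    sumˢ (λ K → sumˢ (λ T → incidences K T))
      ≡⟨ additive-commutes-sumˢ sumˢ sumˢ-distrib-+ (λ T K → incidences K T) ⟩
    sumˢ (λ T → sumˢ (λ K → incidences K T))
      ≡⟨ sumˢ-cong incidences-at-point-set ⟩
    sumˢ {n} (λ T → 𝟙 (∣ T ∣ ≟ t) * 𝟙 (T ⊆? ⊤))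
      ≡⟨ sumˢ-subsets-of-size t (⊤ {n}) ⟩
    ∣ ⊤ {n} ∣ C t
      ≡⟨ cong (_C t) (∣⊤∣≡n n) ⟩
    n C t ∎

-- The images under the rows of the array as a large set.

module _ {t k lam : ℕ} (𝓢 : SteinerSystem t k n) (𝓟 : PerpendicularArray lam k n n) where
  open SteinerSystem 𝓢
  open PerpendicularArray 𝓟

  private
    π : Fin (lam * (n C k)) → Permutation′ n
    π r = injective⇒permutation (row r) (row-distinct r)

  images-multiplicity : ∀ K → ∣ K ∣ ≡ k →
                        number (λ r → SteinerSystem.Block? (imageSystem 𝓢 (π r)) K) ≡
                        lam * #blocks 𝓢
  images-multiplicity K ∣K∣≡k = begin
    number (λ r → Block? (π⁻¹ r K))
      ≡⟨ count-tabulate (λ r → Block? (π⁻¹ r K)) id ⟩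
    sum (λ r → 𝟙 (Block? (π⁻¹ r K)))
      -- Each row's term is spread over all candidates `S` for the preimage of `K`, so that rows can
      -- be counted for each fixed `S` after the exchange.
      ≡⟨ sum-cong-≗ (λ r → sumˢ-δ (π⁻¹ r K) (λ S → 𝟙 (Block? S))) ⟨
    sum (λ r → sumˢ (λ S → 𝟙 (S ≟ˢ π⁻¹ r K) * 𝟙 (Block? S)))
      ≡⟨ sum-cong-≗ (λ r → sumˢ-cong λ S → cong (_* 𝟙 (Block? S))
           (𝟙-cong (entries≡⇔≡image-flip (π r) S K)
                   (entries (row r) S ≟ˢ K) (S ≟ˢ π⁻¹ r K))) ⟨
    sum (λ r → sumˢ (λ S → 𝟙 (entries (row r) S ≟ˢ K) * 𝟙 (Block? S)))
      ≡⟨ additive-commutes-sumˢ sum ∑-distrib-+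
           (λ S r → 𝟙 (entries (row r) S ≟ˢ K) * 𝟙 (Block? S)) ⟩
    sumˢ (λ S → sum (λ r → 𝟙 (entries (row r) S ≟ˢ K) * 𝟙 (Block? S)))
      ≡⟨ sumˢ-cong (λ S → *-distribʳ-sum (𝟙 (Block? S)) (λ r → 𝟙 (entries (row r) S ≟ˢ K))) ⟨
    sumˢ (λ S → sum (λ r → 𝟙 (entries (row r) S ≟ˢ K)) * 𝟙 (Block? S))
      ≡⟨ sumˢ-cong rows-mapping-block ⟩
    sumˢ (λ S → lam * 𝟙 (Block? S))
      ≡⟨ *-distribˡ-sumˢ lam (λ S → 𝟙 (Block? S)) ⟨
    lam * #blocks 𝓢 ∎
    where
    π⁻¹ : Fin (lam * (n C k)) → Subset n → Subset n
    π⁻¹ r = image (flip (π r))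

    -- A block has size `k`, so the array property applies to it as a set of columns; for any other
    -- `S` both sides vanish.
    rows-mapping-block : ∀ S → sum (λ r → 𝟙 (entries (row r) S ≟ˢ K)) * 𝟙 (Block? S) ≡
                               lam * 𝟙 (Block? S)
    rows-mapping-block S with Block? S
    ... | no _  = trans (*-zeroʳ (sum λ r → 𝟙 (entries (row r) S ≟ˢ K))) (sym (*-zeroʳ lam))
    ... | yes B = cong (_* 1) (trans
      (sym (count-tabulate (λ r → entries (row r) S ≟ˢ K) id))
      (occurrences S (block-size B) K ∣K∣≡k))

theorem8 : ∀ (t k n lam : ℕ) → 0 < t → t < k → k ≤ n → 0 < lam →
    SteinerSystem t k n → PerpendicularArray lam k n n →
    ∃[ μ ] (μ * (k C t) ≡ lam * (n C t) × LargeSet t k n μ)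
-- With this `μ` the quotient in the claim is exact: multiplying the block count identity by `lam`
-- gives the product form. The family has one system per row, repetitions included.
theorem8 t k n lam _ _ _ _ 𝓢 𝓟 = lam * #blocks 𝓢
  , trans (*-assoc lam (#blocks 𝓢) (k C t)) (cong (lam *_) (#blocks*kCt≡nCt 𝓢))
  , record
    { size         = lam * (n C k)
    ; system       = λ r → imageSystem 𝓢 (injective⇒permutation (row r) (row-distinct r))
    ; multiplicity = images-multiplicity 𝓢 𝓟
    }
  where open PerpendicularArray 𝓟
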